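{- For every cubic graph $G$, $\nu_3(G) \geq \frac{7}{6}\cdot |V(G)|$.
   Context: Graphs are finite, without loops, possibly with multiple edges; a graph is cubic if every vertex has degree $3$. For $k\geq 1$, $\nu_k(G)$ is the maximum number of edges of a $k$-edge-colorable subgraph of $G$. -}

module Defs where

open import Data.Fin using (Fin; zero; finToFun; funToFin)
open import Data.Fin.Properties using (_≟_; any?; all?; finToFun-funToFin)
open import Data.Fin.Subset using (Subset; _∈_; ∣_∣; ⊥)
open import Data.Fin.Subset.Properties using (_∈?_; anySubset?; ∣p∣≤n; ∣⊥∣≡0; ∉⊥)
open import Data.Nat as ℕ using (ℕ; zero; suc; _≤_; s≤s; NonZero)
open import Data.Nat.Properties using (m≤n⇒m<n∨m≡n)
open import Data.Product using (∃-syntax; _×_; _,_; proj₁; proj₂)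
open import Data.Sum using (_⊎_; inj₁; inj₂)
open import Data.Vec using (tabulate)
open import Level using (0ℓ)
open import Relation.Binary.PropositionalEquality
  using (_≡_; _≢_; refl; sym; trans)
open import Relation.Nullary using (Dec; yes; no; does; contradiction)
open import Relation.Nullary.Decidable using (_×-dec_; _⊎-dec_; _→-dec_; ¬?; map′)
open import Relation.Unary using (Pred; Decidable)

-- Distinct edges may have the same ends.  The order of the two ends carries
-- no meaning: Incident, through which everything else is defined, ignores it.
record Multigraph : Set where
  field
    |V| |E|  : ℕ
    ends     : Fin |E| → Fin |V| × Fin |V|
    loopless : ∀ e → proj₁ (ends e) ≢ proj₂ (ends e)

module _ (G : Multigraph) where
  open Multigraph G

  Incident : Fin |V| → Fin |E| → Set
  Incident v e = v ≡ proj₁ (ends e) ⊎ v ≡ proj₂ (ends e)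

  incident? : ∀ v e → Dec (Incident v e)
  incident? v e = (v ≟ proj₁ (ends e)) ⊎-dec (v ≟ proj₂ (ends e))

  edgesAt : Fin |V| → Subset |E|
  edgesAt v = tabulate (λ e → does (incident? v e))

  degree : Fin |V| → ℕ
  degree v = ∣ edgesAt v ∣

  Cubic : Set
  Cubic = ∀ v → degree v ≡ 3

  Adjacent : Fin |E| → Fin |E| → Set
  Adjacent e f = e ≢ f × ∃[ v ] (Incident v e × Incident v f)

  adjacent? : ∀ e f → Dec (Adjacent e f)
  adjacent? e f =
    ¬? (e ≟ f) ×-dec any? (λ v → incident? v e ×-dec incident? v f)

  ProperOn : ∀ {k} → Subset |E| → (Fin |E| → Fin k) → Set
  ProperOn H c = ∀ e f → e ∈ H → f ∈ H → Adjacent e f → c e ≢ c f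

  properOn? : ∀ {k} H (c : Fin |E| → Fin k) → Dec (ProperOn H c)
  properOn? H c = all? λ e → all? λ f →
    (e ∈? H) →-dec ((f ∈? H) →-dec (adjacent? e f →-dec ¬? (c e ≟ c f)))

  -- A subgraph is given by its edge set H, since its vertex set affects
  -- neither its edge colourings nor its number of edges.  The values of a
  -- colouring outside H are irrelevant; as k ≥ 1 wherever this is used,
  -- every colouring of H extends to all of Fin |E|.
  EdgeColourable : ℕ → Subset |E| → Set
  EdgeColourable k H = ∃[ c ] ProperOn {k} H c

  edgeColourable? : ∀ k → Decidable (EdgeColourable k)
  edgeColourable? k H = map′
    (λ (i , p) → finToFun i , p)
    (λ (c , p) → funToFin c , λ e f e∈ f∈ adj eq →
      p e f e∈ f∈ adj
        (trans (sym (finToFun-funToFin c e)) (trans eq (finToFun-funToFin c f))))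
    (any? {n = k ℕ.^ |E|} (λ i → properOn? H (finToFun i)))

  HasColourable : ℕ → Pred ℕ 0ℓ
  HasColourable k s = ∃[ H ] (EdgeColourable k H × ∣ H ∣ ≡ s)

  hasColourable? : ∀ k → Decidable (HasColourable k)
  hasColourable? k s =
    anySubset? (λ H → edgeColourable? k H ×-dec (∣ H ∣ ℕ.≟ s))

-- The greatest s ≤ b satisfying P (0 if there is none).
greatest : ∀ {P : Pred ℕ 0ℓ} → Decidable P → ℕ → ℕ
greatest P? zero    = zero
greatest P? (suc b) with P? (suc b)
... | yes _ = suc b
... | no  _ = greatest P? b

greatest-satisfies : ∀ {P : Pred ℕ 0ℓ} (P? : Decidable P) b → P 0 → P (greatest P? b)
greatest-satisfies P? zero    p₀ = p₀
greatest-satisfies P? (suc b) p₀ with P? (suc b)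
... | yes p = p
... | no  _ = greatest-satisfies P? b p₀

greatest-upper : ∀ {P : Pred ℕ 0ℓ} (P? : Decidable P) b {s} →
                 P s → s ≤ b → s ≤ greatest P? b
greatest-upper P? zero    p s≤b = s≤b
greatest-upper P? (suc b) p s≤b with P? (suc b)
... | yes _ = s≤b
... | no ¬p with m≤n⇒m<n∨m≡n s≤b
...   | inj₁ (s≤s s≤b′) = greatest-upper P? b p s≤b′
...   | inj₂ refl       = contradiction p ¬p

ν : ∀ k .{{_ : NonZero k}} → Multigraph → ℕ
ν k G = greatest (hasColourable? G k) (Multigraph.|E| G)

ν-attained : ∀ k .{{_ : NonZero k}} G →
             ∃[ H ] (EdgeColourable G k H × ∣ H ∣ ≡ ν k G)
ν-attained (suc k) G = greatest-satisfies (hasColourable? G (suc k)) |E|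
  (⊥ , ((λ _ → zero) , λ _ _ e∈⊥ → contradiction e∈⊥ ∉⊥) , ∣⊥∣≡0 |E|)
  where open Multigraph G

ν-upper : ∀ k .{{_ : NonZero k}} G H → EdgeColourable G k H → ∣ H ∣ ≤ ν k G
ν-upper k G H col =
  greatest-upper (hasColourable? G k) (Multigraph.|E| G) (H , col , refl) (∣p∣≤n H)

{-# OPTIONS --safe #-}
module Submission where

-- Take a partial proper 3-edge-colouring leaving as few edges as possible
-- uncoloured.  By a Kempe swap the uncoloured edges form a matching.  An uncoloured
-- edge uv has a colour b missing at v, which is then present at u, on an edge uw say;
-- moving b from uw to uv gives another optimal colouring.  As the uncoloured edges
-- still form a matching after one or two such moves, w is not the end of an
-- uncoloured edge and differs for different uncoloured edges.  The triples {u, v, w}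
-- are therefore disjoint, so at most |V|/3 of the 3|V|/2 edges are uncoloured.

open import Defs
open import Data.Bool using (Bool; true; false; not)
open import Data.Bool.Properties using () renaming (_≟_ to _≟ᵇ_; ¬-not to ≢⇒≡not)
open import Data.Empty using (⊥; ⊥-elim)
open import Data.Fin using (Fin; zero; suc; combine; remQuot; splitAt; join; punchIn)
open import Data.Fin.Permutation.Components using (transpose; transpose-inverse)
open import Data.Fin.Properties
  using (_≟_; any?; all?; suc-injective; injective⇒≤; combine-injective;
         combine-remQuot; join-splitAt; punchIn-injective; punchInᵢ≢i)
open import Data.Fin.Subset
  using (Subset; inside; outside; _∈_; _∉_; _⊆_; _⊃_; ∣_∣; ∁; ⁅_⁆; _∪_)
open import Data.Fin.Subset.Induction using (⊃-wellFounded; Acc; acc)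
open import Data.Fin.Subset.Properties
  using (_∈?_; p⊆q⇒∣p∣≤∣q∣; p⊂q⇒∣p∣<∣q∣; ∣∁p∣≡n∸∣p∣;
         x∉p⇒x∈∁p; x∈∁p⇒x∉p; p⊆p∪q; x∈p∪q⁺; x∈p∪q⁻; x∈⁅x⁆; x∈⁅y⁆⇒x≡y)
open import Data.Integer using (+_)
import Data.Integer as ℤ
import Data.Integer.Properties as ℤ
open import Data.Maybe using (Maybe; just; nothing; fromMaybe)
import Data.Maybe as Maybe
open import Data.Maybe.Properties using (≡-dec; just-injective)
open import Data.Nat as ℕ using (ℕ; _+_; _∸_; _≤_; _<_)
import Data.Nat.Properties as ℕ
open import Data.Nat.Solver using (module +-*-Solver)
open import Data.Product using (∃₂; ∃-syntax; _×_; _,_; proj₁; proj₂; uncurry)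
open import Data.Rational using (_/_; _*_; _≥_; toℚᵘ)
import Data.Rational.Properties as ℚ
import Data.Rational.Unnormalised as ℚᵘ
import Data.Rational.Unnormalised.Properties as ℚᵘ
open import Data.Sum using (_⊎_; inj₁; inj₂; [_,_]′)
open import Data.Vec using (tabulate; _∷_; here; there)
open import Data.Vec.Functional using (updateAt)
open import Data.Vec.Functional.Properties using (updateAt-updates; updateAt-minimal)
open import Data.Vec.Properties using (lookup∘tabulate; []=⇒lookup; lookup⇒[]=)
open import Function using (_∘_; id; const; case_of_)
open import Relation.Binary.PropositionalEquality
  using (_≡_; _≢_; refl; sym; trans; cong; cong₂; subst; subst₂; subst-injective)
open import Relation.Nullary using (¬_; Dec; yes; no; does; contradiction)
open import Relation.Nullary.Decidable
  using (dec-true; dec-false; decidable-stable; from-yes; _×-dec_; _→-dec_; ¬?)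

-- Enumerating subsets and counting by injections.

module _ {n : ℕ} {P : Fin n → Set} (P? : ∀ x → Dec (P x)) where

  ∈-tabulate⁺ : ∀ {x} → P x → x ∈ tabulate (does ∘ P?)
  ∈-tabulate⁺ {x} px =
    lookup⇒[]= x _ (trans (lookup∘tabulate (does ∘ P?) x) (dec-true (P? x) px))

  ∈-tabulate⁻ : ∀ {x} → x ∈ tabulate (does ∘ P?) → P x
  ∈-tabulate⁻ {x} x∈ with P? x | trans (sym (lookup∘tabulate (does ∘ P?) x)) ([]=⇒lookup x∈)
  ... | yes px | _ = px

nth : ∀ {n} (p : Subset n) → Fin ∣ p ∣ → Fin n
nth (inside  ∷ p) zero    = zero
nth (inside  ∷ p) (suc i) = suc (nth p i)
nth (outside ∷ p) i       = suc (nth p i)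

nth-∈ : ∀ {n} (p : Subset n) i → nth p i ∈ p
nth-∈ (inside  ∷ p) zero    = here
nth-∈ (inside  ∷ p) (suc i) = there (nth-∈ p i)
nth-∈ (outside ∷ p) i       = there (nth-∈ p i)

nth-injective : ∀ {n} (p : Subset n) {i j} → nth p i ≡ nth p j → i ≡ j
nth-injective (inside  ∷ p) {zero}  {zero}  _  = refl
nth-injective (inside  ∷ p) {suc i} {suc j} eq = cong suc (nth-injective p (suc-injective eq))
nth-injective (outside ∷ p)                 eq = nth-injective p (suc-injective eq)

index : ∀ {n} (p : Subset n) {x} → x ∈ p → Fin ∣ p ∣
index (inside  ∷ p) here       = zero
index (inside  ∷ p) (there x∈) = suc (index p x∈)
index (outside ∷ p) (there x∈) = index p x∈

nth-index : ∀ {n} (p : Subset n) {x} (x∈ : x ∈ p) → nth p (index p x∈) ≡ x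
nth-index (inside  ∷ p) here       = refl
nth-index (inside  ∷ p) (there x∈) = cong suc (nth-index p x∈)
nth-index (outside ∷ p) (there x∈) = cong suc (nth-index p x∈)

injective-into⇒≤ : ∀ {m n} (p : Subset n) (f : Fin m → Fin n) → (∀ i → f i ∈ p) →
                   (∀ {i j} → f i ≡ f j → i ≡ j) → m ≤ ∣ p ∣
injective-into⇒≤ p f f∈ f-inj = injective⇒≤ {f = λ i → index p (f∈ i)} λ {i} {j} eq →
  f-inj (trans (sym (nth-index p (f∈ i))) (trans (cong (nth p) eq) (nth-index p (f∈ j))))

injective-on⇒∣p∣≤∣q∣ : ∀ {n} (p q : Subset n) (f : Fin n → Fin n) → (∀ {x} → x ∈ p → f x ∈ q) →
                       (∀ {x y} → x ∈ p → y ∈ p → f x ≡ f y → x ≡ y) → ∣ p ∣ ≤ ∣ q ∣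
injective-on⇒∣p∣≤∣q∣ p q f f∈ f-inj =
  injective-into⇒≤ q (f ∘ nth p) (λ i → f∈ (nth-∈ p i))
    λ {i} {j} eq → nth-injective p (f-inj (nth-∈ p i) (nth-∈ p j) eq)

pairs-injective⇒≤ : ∀ {m k n} (f : Fin m → Fin k → Fin n) →
                    (∀ {i i′ j j′} → f i j ≡ f i′ j′ → i ≡ i′ × j ≡ j′) → m ℕ.* k ≤ n
pairs-injective⇒≤ {m} {k} f f-inj = injective⇒≤ {f = λ r → uncurry f (remQuot {m} k r)} λ {r} {s} eq →
  trans (sym (combine-remQuot {m} k r))
    (trans (uncurry (cong₂ combine) (f-inj eq)) (combine-remQuot {m} k s))

-- Components generated by two involutions.

-- The alternating walk from u under f false, f true, f false, … visits S; its
-- tip t is the only point of S at which S may fail to be closed, namely under f δ.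
module AlternatingWalk {n : ℕ} (f : Bool → Fin n → Fin n)
                       (f-invol : ∀ b x → f b (f b x) ≡ x) where

  Closed : Subset n → Set
  Closed S = ∀ b {x} → x ∈ S → f b x ∈ S

  AtMostOneFixed : Subset n → Set
  AtMostOneFixed S = ∀ {x y} → x ∈ S → y ∈ S → f false x ≡ x → f false y ≡ y → x ≡ y

  -- The last hypothesis says that a fixed point of `f false` can only be the tip, at a moment when
  -- the next step is `f false`. The walk stops there, so no second such point is ever added. Every
  -- other step makes the set strictly larger, hence the recursion on `_⊃_`.
  grow : ∀ S → Acc _⊃_ S → ∀ t δ → t ∈ S →
         (∀ b {x} → x ∈ S → f b x ∈ S ⊎ (x ≡ t × b ≡ δ)) →
         (∀ {x} → x ∈ S → f false x ≡ x → x ≡ t × δ ≡ false) →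
         ∃[ T ] (S ⊆ T × Closed T × AtMostOneFixed T)
  grow S (acc rec) t δ t∈S closed fixed with f δ t ∈? S
  ... | yes t′∈S = S , id , closed′ ,
          λ x∈ y∈ fx fy → trans (proj₁ (fixed x∈ fx)) (sym (proj₁ (fixed y∈ fy)))
    where
    closed′ : Closed S
    closed′ b x∈ with closed b x∈
    ... | inj₁ fx∈           = fx∈
    ... | inj₂ (refl , refl) = t′∈S
  ... | no t′∉S =
    let T , S′⊆T , rest = grow S′ (rec (S⊆S′ , t′ , t′∈S′ , t′∉S)) t′ (not δ) t′∈S′ closed′ fixed′
    in T , S′⊆T ∘ S⊆S′ , rest
    where
    t′ = f δ t
    S′ = S ∪ ⁅ t′ ⁆

    S⊆S′ : S ⊆ S′
    S⊆S′ = p⊆p∪q ⁅ t′ ⁆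

    t′∈S′ : t′ ∈ S′
    t′∈S′ = x∈p∪q⁺ (inj₂ (x∈⁅x⁆ t′))

    closed′ : ∀ b {x} → x ∈ S′ → f b x ∈ S′ ⊎ (x ≡ t′ × b ≡ not δ)
    closed′ b x∈ with x∈p∪q⁻ S ⁅ t′ ⁆ x∈
    closed′ b x∈ | inj₁ x∈S with closed b x∈S
    ... | inj₁ fx∈           = inj₁ (S⊆S′ fx∈)
    ... | inj₂ (refl , refl) = inj₁ t′∈S′
    closed′ b x∈ | inj₂ x∈t′ with x∈⁅y⁆⇒x≡y t′ x∈t′ | b ≟ᵇ δ
    ... | refl | yes refl = inj₁ (S⊆S′ (subst (_∈ S) (sym (f-invol δ t)) t∈S))
    ... | refl | no b≢δ   = inj₂ (refl , ≢⇒≡not b≢δ)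

    fixed′ : ∀ {x} → x ∈ S′ → f false x ≡ x → x ≡ t′ × not δ ≡ false
    fixed′ x∈ fx with x∈p∪q⁻ S ⁅ t′ ⁆ x∈
    fixed′ x∈ fx | inj₁ x∈S with fixed x∈S fx
    -- The old tip would be fixed by the step just taken, so that step would not have left `S`.
    ... | refl , refl = contradiction (subst (_∈ S) (sym fx) t∈S) t′∉S
    fixed′ x∈ fx | inj₂ x∈t′ with x∈⁅y⁆⇒x≡y t′ x∈t′
    -- Had `f false` led from `t` to `t′`, it would lead back from `t′` to `t`; as it fixes `t′`,
    -- this would put `t′` in `S`.
    ... | refl = refl , cong not (≢⇒≡not λ δ≡false → t′∉S (subst (_∈ S)
            (trans (sym (f-invol δ t)) (subst (λ b → f b t′ ≡ t′) (sym δ≡false) fx)) t∈S))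

  -- Here `u` is an end of its path in the union of two matchings. The path has only one further
  -- end, which leaves room for at most one fixed point of `f false`.
  component : ∀ u → f true u ≡ u → ∃[ T ] (u ∈ T × Closed T × AtMostOneFixed T)
  component u fu =
    let T , ⊆T , rest = grow ⁅ u ⁆ (⊃-wellFounded ⁅ u ⁆) u false (x∈⁅x⁆ u) closed₀
                          (λ x∈ _ → x∈⁅y⁆⇒x≡y u x∈ , refl)
    in T , ⊆T (x∈⁅x⁆ u) , rest
    where
    closed₀ : ∀ b {x} → x ∈ ⁅ u ⁆ → f b x ∈ ⁅ u ⁆ ⊎ (x ≡ u × b ≡ false)
    closed₀ b x∈ with x∈⁅y⁆⇒x≡y u x∈
    closed₀ false x∈ | refl = inj₂ (refl , refl)
    closed₀ true  x∈ | refl = inj₁ (subst (_∈ ⁅ u ⁆) (sym fu) x∈)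

-- Transpositions of colours.

transpose-injective : ∀ {n} (i j : Fin n) {k l} → transpose i j k ≡ transpose i j l → k ≡ l
transpose-injective i j eq =
  trans (sym (transpose-inverse j i)) (trans (cong (transpose j i) eq) (transpose-inverse j i))

transpose-left : ∀ {n} (i j : Fin n) → transpose i j i ≡ j
transpose-left i j rewrite dec-true (i ≟ i) refl = refl

transpose-minimal : ∀ {n} {i j k : Fin n} → k ≢ i → k ≢ j → transpose i j k ≡ k
transpose-minimal {i = i} {j} {k} k≢i k≢j
  rewrite dec-false (k ≟ i) k≢i | dec-false (k ≟ j) k≢j = refl

-- Partial edge colourings of a multigraph.

module PartialColouring (G : Multigraph) where
  open Multigraph G

  -- Two distinct vertices incident with an edge are its two ends, so this is a form of `ends` that
  -- is symmetric in `u` and `v`.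
  Joins : Fin |E| → Fin |V| → Fin |V| → Set
  Joins e u v = u ≢ v × Incident G u e × Incident G v e

  joins-ends : ∀ e → Joins e (proj₁ (ends e)) (proj₂ (ends e))
  joins-ends e = loopless e , inj₁ refl , inj₂ refl

  joins-sym : ∀ {e u v} → Joins e u v → Joins e v u
  joins-sym (u≢v , ue , ve) = u≢v ∘ sym , ve , ue

  incident⇒joins : ∀ {e u} → Incident G u e → ∃[ v ] Joins e u v
  incident⇒joins {e} (inj₁ refl) = _ , joins-ends e
  incident⇒joins {e} (inj₂ refl) = _ , joins-sym (joins-ends e)

  joins-only : ∀ {e u v x} → Joins e u v → Incident G x e → x ≡ u ⊎ x ≡ v
  joins-only (u≢v , inj₁ refl , inj₁ refl) _ = contradiction refl u≢v
  joins-only (u≢v , inj₂ refl , inj₂ refl) _ = contradiction refl u≢v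
  joins-only (u≢v , inj₁ refl , inj₂ refl) xe = xe
  joins-only (u≢v , inj₂ refl , inj₁ refl) (inj₁ xe) = inj₂ xe
  joins-only (u≢v , inj₂ refl , inj₁ refl) (inj₂ xe) = inj₁ xe

  joins-unique : ∀ {e u v w} → Joins e u v → Joins e u w → v ≡ w
  joins-unique uv (u≢w , _ , we) with joins-only uv we
  ... | inj₁ w≡u = contradiction (sym w≡u) u≢w
  ... | inj₂ w≡v = sym w≡v

  Colouring : ℕ → Set
  Colouring k = Fin |E| → Maybe (Fin k)

  module _ {k : ℕ} where

    Proper : Colouring k → Set
    Proper c = ∀ {x e f a} → Incident G x e → Incident G x f →
               c e ≡ just a → c f ≡ just a → e ≡ f

    Missing : Colouring k → Fin |V| → Fin k → Set
    Missing c x a = ∀ e → Incident G x e → c e ≢ just a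

    Present : Colouring k → Fin |V| → Fin k → Set
    Present c x a = ∃[ e ] (Incident G x e × c e ≡ just a)

    present? : ∀ c x a → Dec (Present c x a)
    present? c x a = any? λ e → incident? G x e ×-dec ≡-dec _≟_ (c e) (just a)

    ¬present⇒missing : ∀ {c x a} → ¬ Present c x a → Missing c x a
    ¬present⇒missing ¬p e xe ce = ¬p (e , xe , ce)

    missing? : ∀ c x a → Dec (Missing c x a)
    missing? c x a = all? λ e → incident? G x e →-dec ¬? (≡-dec _≟_ (c e) (just a))

    ¬missing⇒present : ∀ {c x a} → ¬ Missing c x a → Present c x a
    ¬missing⇒present {c} {x} {a} ¬m =
      decidable-stable (present? c x a) (¬m ∘ ¬present⇒missing)

    uncoloured? : ∀ (c : Colouring k) e → Dec (c e ≡ nothing)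
    uncoloured? c e = ≡-dec _≟_ (c e) nothing

    uncoloured : Colouring k → Subset |E|
    uncoloured c = tabulate (does ∘ uncoloured? c)

    Optimal : Colouring k → Set
    Optimal c = Proper c × (∀ c′ → Proper c′ → ∣ uncoloured c ∣ ≤ ∣ uncoloured c′ ∣)

    uncolour : Colouring k → Fin |E| → Colouring k
    uncolour c e = updateAt c e (const nothing)

    colour : Colouring k → Fin |E| → Fin k → Colouring k
    colour c e a = updateAt c e (const (just a))

    uncolour-just⁻ : ∀ {c e f a} → uncolour c e f ≡ just a → f ≢ e × c f ≡ just a
    uncolour-just⁻ {c} {e} {f} eq with f ≟ e
    ... | yes refl = case trans (sym (updateAt-updates e c)) eq of λ ()
    ... | no  f≢e  = f≢e , trans (sym (updateAt-minimal f e c f≢e)) eq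

    colour-just⁻ : ∀ {c e f a b} → colour c e a f ≡ just b → (f ≡ e × a ≡ b) ⊎ c f ≡ just b
    colour-just⁻ {c} {e} {f} eq with f ≟ e
    ... | yes refl = inj₁ (refl , just-injective (trans (sym (updateAt-updates e c)) eq))
    ... | no  f≢e  = inj₂ (trans (sym (updateAt-minimal f e c f≢e)) eq)

    colour-nothing⁻ : ∀ {c e f a} → colour c e a f ≡ nothing → f ≢ e × c f ≡ nothing
    colour-nothing⁻ {c} {e} {f} eq with f ≟ e
    ... | yes refl = case trans (sym (updateAt-updates e c)) eq of λ ()
    ... | no  f≢e  = f≢e , trans (sym (updateAt-minimal f e c f≢e)) eq

    uncolour-proper : ∀ {c e} → Proper c → Proper (uncolour c e)
    uncolour-proper proper xf xg cf cg =
      proper xf xg (proj₂ (uncolour-just⁻ cf)) (proj₂ (uncolour-just⁻ cg))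

    colour-proper : ∀ {c e u v a} → Proper c → Joins e u v →
                    Missing c u a → Missing c v a → Proper (colour c e a)
    colour-proper {c} {e} {u} {v} {a} proper uv mu mv xf xg cf cg
      with colour-just⁻ cf | colour-just⁻ cg
    ... | inj₁ (refl , refl) | inj₁ (refl , _) = refl
    ... | inj₂ cf′           | inj₂ cg′        = proper xf xg cf′ cg′
    ... | inj₁ (refl , refl) | inj₂ cg′ with joins-only uv xf
    ...   | inj₁ refl = contradiction cg′ (mu _ xg)
    ...   | inj₂ refl = contradiction cg′ (mv _ xg)
    colour-proper {c} {e} {u} {v} {a} proper uv mu mv xf xg cf cg
        | inj₂ cf′           | inj₁ (refl , refl) with joins-only uv xg
    ...   | inj₁ refl = contradiction cf′ (mu _ xf)
    ...   | inj₂ refl = contradiction cf′ (mv _ xf)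

    -- Otherwise `e` could be given the colour `a`, which leaves strictly fewer edges uncoloured.
    no-common-missing : ∀ {c e u v a} → Optimal c → c e ≡ nothing → Joins e u v →
                        Missing c u a → Missing c v a → ⊥
    no-common-missing {c} {e} {a = a} (proper , optimal) ce uv mu mv =
      ℕ.<⇒≱ (p⊂q⇒∣p∣<∣q∣ (fewer , e , ∈-tabulate⁺ (uncoloured? c) ce , e∉))
            (optimal (colour c e a) (colour-proper proper uv mu mv))
      where
      fewer : uncoloured (colour c e a) ⊆ uncoloured c
      fewer f∈ = ∈-tabulate⁺ (uncoloured? c)
        (proj₂ (colour-nothing⁻ (∈-tabulate⁻ (uncoloured? (colour c e a)) f∈)))
      e∉ : e ∉ uncoloured (colour c e a)
      e∉ e∈ = proj₁ (colour-nothing⁻ {c = c} (∈-tabulate⁻ (uncoloured? (colour c e a)) e∈)) refl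

    -- Moving a colour to an adjacent uncoloured edge.

    rotate : Colouring k → Fin |E| → Fin |E| → Fin k → Colouring k
    rotate c e g b = colour (uncolour c g) e b

    rotate-just⁻ : ∀ {c e g f a b} → rotate c e g b f ≡ just a → f ≡ e ⊎ (f ≢ g × c f ≡ just a)
    rotate-just⁻ {c} {e} {g} eq with colour-just⁻ {c = uncolour c g} {e} eq
    ... | inj₁ (f≡e , _) = inj₁ f≡e
    ... | inj₂ eq′       = inj₂ (uncolour-just⁻ eq′)

    rotate-at : ∀ {c e g b} → e ≢ g → rotate c e g b g ≡ nothing
    rotate-at {c} {e} {g} e≢g =
      trans (updateAt-minimal g e (uncolour c g) (e≢g ∘ sym)) (updateAt-updates g c)

    rotate-minimal : ∀ {c e g b f} → f ≢ e → f ≢ g → rotate c e g b f ≡ c f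
    rotate-minimal {c} {e} {g} {f = f} f≢e f≢g =
      trans (updateAt-minimal f e (uncolour c g) f≢e) (updateAt-minimal f g c f≢g)

    -- By properness `g` is the only edge at `u` coloured `b`, so once it is uncoloured both ends of
    -- `e` miss `b`. One edge gains a colour and one loses it.
    rotate-optimal : ∀ {c e g u v b} → Optimal c → c e ≡ nothing → Joins e u v →
                     Missing c v b → Incident G u g → c g ≡ just b → Optimal (rotate c e g b)
    rotate-optimal {c} {e} {g} {u} {v} {b} (proper , optimal) ce uv mv ug cg =
      colour-proper (uncolour-proper proper) uv mu′ mv′ ,
      λ c″ proper″ → ℕ.≤-trans fewer (optimal c″ proper″)
      where
      c′ = rotate c e g b

      mu′ : Missing (uncolour c g) u b
      mu′ f uf eq = let f≢g , cf = uncolour-just⁻ eq in f≢g (proper uf ug cf cg)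

      mv′ : Missing (uncolour c g) v b
      mv′ f vf eq = mv f vf (proj₂ (uncolour-just⁻ eq))

      -- An injection from the new uncoloured edges to the old ones, with `e` standing in for `g`.
      φ : Fin |E| → Fin |E|
      φ f with f ≟ g
      ... | yes _ = e
      ... | no  _ = f

      φ-∈ : ∀ {f} → f ∈ uncoloured c′ → φ f ∈ uncoloured c
      φ-∈ {f} f∈ with f ≟ g
      ... | yes _  = ∈-tabulate⁺ (uncoloured? c) ce
      ... | no f≢g = ∈-tabulate⁺ (uncoloured? c) (trans (sym (updateAt-minimal f g c f≢g))
              (proj₂ (colour-nothing⁻ (∈-tabulate⁻ (uncoloured? c′) f∈))))

      e∉ : e ∉ uncoloured c′
      e∉ e∈ = proj₁ (colour-nothing⁻ {c = uncolour c g} (∈-tabulate⁻ (uncoloured? c′) e∈)) refl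

      φ-injective : ∀ {f h} → f ∈ uncoloured c′ → h ∈ uncoloured c′ → φ f ≡ φ h → f ≡ h
      φ-injective {f} {h} f∈ h∈ eq with f ≟ g | h ≟ g
      ... | yes f≡g | yes h≡g = trans f≡g (sym h≡g)
      ... | yes _   | no  _   = contradiction (subst (_∈ uncoloured c′) (sym eq) h∈) e∉
      ... | no  _   | yes _   = contradiction (subst (_∈ uncoloured c′) eq f∈) e∉
      ... | no  _   | no  _   = eq

      fewer : ∣ uncoloured c′ ∣ ≤ ∣ uncoloured c ∣
      fewer = injective-on⇒∣p∣≤∣q∣ (uncoloured c′) (uncoloured c) φ φ-∈ φ-injective

    -- Kempe swaps.

    -- The involution belonging to the matching of edges coloured `a`; its fixed points are the
    -- vertices missing `a`. Kempe chains thereby become sets closed under two involutions.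
    mate : Colouring k → Fin k → Fin |V| → Fin |V|
    mate c a x with present? c x a
    ... | yes (e , xe , _) = proj₁ (incident⇒joins xe)
    ... | no  _            = x

    mate-joins : ∀ {c a e x y} → Proper c → Joins e x y → c e ≡ just a → mate c a x ≡ y
    mate-joins {c} {a} {e} {x} proper xy ce with present? c x a
    ... | no ¬p = contradiction (e , proj₁ (proj₂ xy) , ce) ¬p
    ... | yes (f , xf , cf) with proper (proj₁ (proj₂ xy)) xf ce cf
    ...   | refl = joins-unique (proj₂ (incident⇒joins xf)) xy

    mate-missing : ∀ {c a x} → Missing c x a → mate c a x ≡ x
    mate-missing {c} {a} {x} m with present? c x a
    ... | no _              = refl
    ... | yes (f , xf , cf) = contradiction cf (m f xf)

    mate-involutive : ∀ {c} a → Proper c → ∀ x → mate c a (mate c a x) ≡ x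
    mate-involutive {c} a proper x = case present? c x a of λ where
      (no ¬p) → let fixed = mate-missing (¬present⇒missing ¬p)
                in trans (cong (mate c a) fixed) fixed
      (yes (e , xe , ce)) → let y , xy = incident⇒joins xe in
        trans (cong (mate c a) (mate-joins proper xy ce)) (mate-joins proper (joins-sym xy) ce)

    MateClosed : Colouring k → Fin k → Subset |V| → Set
    MateClosed c a S = ∀ {x} → x ∈ S → mate c a x ∈ S

    closed-edge : ∀ {c a S e x y} → Proper c → MateClosed c a S → c e ≡ just a →
                  Incident G x e → Incident G y e → x ∈ S → y ∈ S
    closed-edge {S = S} proper closed ce xe ye x∈ with incident⇒joins xe
    ... | z , xz with joins-only xz ye
    ...   | inj₁ refl = x∈
    ...   | inj₂ refl = subst (_∈ S) (mate-joins proper xz ce) (closed x∈)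

    -- Testing one end of `e` suffices when `S` is closed under the mates for `a` and `b`: an edge
    -- leaving `S` then has neither colour, and the transposition does not affect it.
    kempe : Colouring k → Fin k → Fin k → Subset |V| → Colouring k
    kempe c a b S e with proj₁ (ends e) ∈? S
    ... | yes _ = Maybe.map (transpose a b) (c e)
    ... | no  _ = c e

    module Kempe {c : Colouring k} {a b : Fin k} {S : Subset |V|} (proper : Proper c)
                 (closedᵃ : MateClosed c a S) (closedᵇ : MateClosed c b S) where

      crossing-fixed : ∀ {e x y} → Incident G x e → Incident G y e → x ∈ S → y ∉ S →
                       Maybe.map (transpose a b) (c e) ≡ c e
      crossing-fixed {e} xe ye x∈ y∉ with c e in ce
      ... | nothing = refl
      ... | just d = cong just (transpose-minimal
              (λ { refl → y∉ (closed-edge proper closedᵃ ce xe ye x∈) })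
              (λ { refl → y∉ (closed-edge proper closedᵇ ce xe ye x∈) }))

      kempe-∈ : ∀ {e x} → Incident G x e → x ∈ S →
                kempe c a b S e ≡ Maybe.map (transpose a b) (c e)
      kempe-∈ {e} xe x∈ with proj₁ (ends e) ∈? S
      ... | yes _ = refl
      ... | no y∉ = sym (crossing-fixed xe (inj₁ refl) x∈ y∉)

      kempe-∉ : ∀ {e x} → Incident G x e → x ∉ S → kempe c a b S e ≡ c e
      kempe-∉ {e} xe x∉ with proj₁ (ends e) ∈? S
      ... | yes y∈ = crossing-fixed (inj₁ refl) xe y∈ x∉
      ... | no _   = refl

      map-just⁻ : ∀ {m d} → Maybe.map (transpose a b) m ≡ just d →
                  ∃[ d′ ] (m ≡ just d′ × transpose a b d′ ≡ d)
      map-just⁻ {just d′} eq = d′ , refl , just-injective eq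

      kempe-proper : Proper (kempe c a b S)
      kempe-proper {x} xe xf ce cf with x ∈? S
      ... | no x∉ = proper xe xf (trans (sym (kempe-∉ xe x∉)) ce) (trans (sym (kempe-∉ xf x∉)) cf)
      ... | yes x∈ with map-just⁻ (trans (sym (kempe-∈ xe x∈)) ce)
                      | map-just⁻ (trans (sym (kempe-∈ xf x∈)) cf)
      ...   | d , ce′ , eq | d′ , cf′ , eq′ =
              proper xe xf ce′ (trans cf′ (cong just (transpose-injective a b (trans eq′ (sym eq)))))

      kempe-uncoloured⁺ : ∀ {e} → c e ≡ nothing → kempe c a b S e ≡ nothing
      kempe-uncoloured⁺ {e} ce with proj₁ (ends e) ∈? S
      ... | yes _ = cong (Maybe.map (transpose a b)) ce
      ... | no  _ = ce

      map-nothing⁻ : ∀ {m} → Maybe.map (transpose a b) m ≡ nothing → m ≡ nothing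
      map-nothing⁻ {nothing} _ = refl

      kempe-uncoloured⁻ : ∀ {e} → kempe c a b S e ≡ nothing → c e ≡ nothing
      kempe-uncoloured⁻ {e} eq with proj₁ (ends e) ∈? S
      ... | yes _ = map-nothing⁻ eq
      ... | no  _ = eq

      kempe-missing-∈ : ∀ {x} → x ∈ S → Missing c x a → Missing (kempe c a b S) x b
      kempe-missing-∈ x∈ m e xe eq with map-just⁻ (trans (sym (kempe-∈ xe x∈)) eq)
      ... | d , ce , d↦b = m e xe (trans ce (cong just
              (transpose-injective a b (trans d↦b (sym (transpose-left a b))))))

      kempe-missing-∉ : ∀ {x} → x ∉ S → Missing c x b → Missing (kempe c a b S) x b
      kempe-missing-∉ x∉ m e xe eq = m e xe (trans (sym (kempe-∉ xe x∉)) eq)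

      kempe-optimal : (∀ c′ → Proper c′ → ∣ uncoloured c ∣ ≤ ∣ uncoloured c′ ∣) →
                      Optimal (kempe c a b S)
      kempe-optimal optimal = kempe-proper , λ c′ proper′ → ℕ.≤-trans
        (p⊆q⇒∣p∣≤∣q∣ λ e∈ → ∈-tabulate⁺ (uncoloured? c)
          (kempe-uncoloured⁻ (∈-tabulate⁻ (uncoloured? (kempe c a b S)) e∈)))
        (optimal c′ proper′)

    -- Pigeonhole at `x`: if all `l` colours were present, the edges carrying them and the `m`
    -- uncoloured edges would be `m + l` distinct edges, more than the degree.
    missing-among : ∀ {c x m l} (g : Fin m → Fin |E|) (s : Fin l → Fin k) →
                    (∀ {i j} → g i ≡ g j → i ≡ j) → (∀ {i j} → s i ≡ s j → i ≡ j) →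
                    (∀ i → Incident G x (g i)) → (∀ i → c (g i) ≡ nothing) →
                    degree G x < m + l → ∃[ i ] Missing c x (s i)
    missing-among {c} {x} {m} {l} g s g-inj s-inj xg cg small
      with any? (λ i → missing? c x (s i))
    ... | yes found = found
    ... | no ¬found = contradiction
            (injective-into⇒≤ (edgesAt G x) (h ∘ splitAt m)
              (λ i → ∈-tabulate⁺ (incident? G x) (h-incident (splitAt m i)))
              λ {i} {j} eq → trans (sym (join-splitAt m l i))
                (trans (cong (join m l) (h-inj {splitAt m i} {splitAt m j} eq)) (join-splitAt m l j)))
            (ℕ.<⇒≱ small)
      where
      present : ∀ i → Present c x (s i)
      present i = ¬missing⇒present λ m → ¬found (i , m)

      h : Fin m ⊎ Fin l → Fin |E|
      h (inj₁ i) = g i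
      h (inj₂ i) = proj₁ (present i)

      h-incident : ∀ i → Incident G x (h i)
      h-incident (inj₁ i) = xg i
      h-incident (inj₂ i) = proj₁ (proj₂ (present i))

      g≢present : ∀ {i j} → g i ≢ proj₁ (present j)
      g≢present {i} {j} eq =
        case trans (sym (cg i)) (trans (cong c eq) (proj₂ (proj₂ (present j)))) of λ ()

      h-inj : ∀ {i j} → h i ≡ h j → i ≡ j
      h-inj {inj₁ i} {inj₁ j} eq = cong inj₁ (g-inj eq)
      h-inj {inj₁ i} {inj₂ j} eq = contradiction eq g≢present
      h-inj {inj₂ i} {inj₁ j} eq = contradiction (sym eq) g≢present
      h-inj {inj₂ i} {inj₂ j} eq = cong inj₂ (s-inj (just-injective
        (trans (sym (proj₂ (proj₂ (present i)))) (trans (cong c eq) (proj₂ (proj₂ (present j)))))))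

third-colour-unique : ∀ (a b c d : Fin 3) → a ≢ b → c ≢ a → c ≢ b → d ≢ a → d ≢ b → c ≡ d
-- A finite statement, settled by evaluating its decision procedure.
third-colour-unique = from-yes decided
  where
  decided : Dec (∀ (a b c d : Fin 3) → a ≢ b → c ≢ a → c ≢ b → d ≢ a → d ≢ b → c ≡ d)
  decided = all? λ a → all? λ b → all? λ c → all? λ d →
    ¬? (a ≟ b) →-dec (¬? (c ≟ a) →-dec (¬? (c ≟ b) →-dec
      (¬? (d ≟ a) →-dec (¬? (d ≟ b) →-dec (c ≟ d)))))

-- Cubic graphs: the uncoloured edges of an optimal colouring form a matching.

module _ {G : Multigraph} (cubic : Cubic G) where
  open Multigraph G
  open PartialColouring G

  missing-one : ∀ {c : Colouring 3} {e x} → Incident G x e → c e ≡ nothing →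
                ∃[ a ] Missing c x a
  missing-one {e = e} {x} xe ce = missing-among {m = 1} {l = 3} (λ _ → e) id
    (λ { {zero} {zero} _ → refl }) id (λ _ → xe) (λ _ → ce) (ℕ.≤-reflexive (cong ℕ.suc (cubic x)))

  missing-two : ∀ {c : Colouring 3} {e f x} → e ≢ f → Incident G x e → Incident G x f →
                c e ≡ nothing → c f ≡ nothing → ∃₂ λ a b → a ≢ b × Missing c x a × Missing c x b
  missing-two {c} {e} {f} {x} e≢f xe xf ce cf =
    let a , ma = missing-one xe ce
        -- `punchIn a` lists the two colours other than `a`; with the two uncoloured edges they make
        -- four, one more than the degree.
        i , mb = missing-among {m = 2} {l = 2} pair (punchIn a) pair-injective
                   (λ {j} {j′} → punchIn-injective a j j′)
                   (λ { zero → xe ; (suc zero) → xf }) (λ { zero → ce ; (suc zero) → cf })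
                   (ℕ.≤-reflexive (cong ℕ.suc (cubic x)))
    in a , punchIn a i , punchInᵢ≢i a i ∘ sym , ma , mb
    where
    pair : Fin 2 → Fin |E|
    pair zero       = e
    pair (suc zero) = f

    pair-injective : ∀ {i j} → pair i ≡ pair j → i ≡ j
    pair-injective {zero}     {zero}     _  = refl
    pair-injective {zero}     {suc zero} eq = contradiction eq e≢f
    pair-injective {suc zero} {zero}     eq = contradiction (sym eq) e≢f
    pair-injective {suc zero} {suc zero} _  = refl

  -- If x has two uncoloured edges, to v and w, then x misses two colours and v, w
  -- both miss the third one, d.  Swap d with a colour a missing at x along the
  -- a/d-path starting at x: it cannot end at both v and w, so afterwards d is
  -- missing at both ends of one of the two edges.
  uncoloured-matching : ∀ {c : Colouring 3} {e f x} → Optimal c →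
                        c e ≡ nothing → c f ≡ nothing → Incident G x e → Incident G x f → e ≡ f
  uncoloured-matching {c} {e} {f} {x} opt@(proper , optimal) ce cf xe xf with e ≟ f
  ... | yes e≡f = e≡f
  ... | no  e≢f = ⊥-elim impossible
    where
    v  = proj₁ (incident⇒joins xe)
    w  = proj₁ (incident⇒joins xf)

    xv : Joins e x v
    xv = proj₂ (incident⇒joins xe)

    xw : Joins f x w
    xw = proj₂ (incident⇒joins xf)

    ve = proj₂ (proj₂ xv)
    wf = proj₂ (proj₂ xw)

    impossible : ⊥
    impossible with missing-two {c} e≢f xe xf ce cf
    ... | a , b , a≢b , ma , mb = case v ≟ w of λ where
        -- If `e` and `f` are parallel, `v` misses two different colours as well, yet each would
        -- have to be the third colour.
        (yes v≡w) → let d , d′ , d≢d′ , md , md′ =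
                          missing-two {c} e≢f ve (subst (λ y → Incident G y f) (sym v≡w) wf) ce cf
                    in d≢d′ (coincide ce ce xv xv md md′)
        (no v≢w) → let d , md = missing-one {c} ve ce
                       d′ , md′ = missing-one {c} wf cf
                   in swap d v≢w md (subst (Missing c w) (sym (coincide ce cf xv xw md md′)) md′)
      where
      differs : ∀ {g y d a′} → c g ≡ nothing → Joins g x y → Missing c y d → Missing c x a′ → d ≢ a′
      differs cg xy md ma refl = no-common-missing opt cg xy ma md

      coincide : ∀ {g h y z d d′} → c g ≡ nothing → c h ≡ nothing → Joins g x y → Joins h x z →
                 Missing c y d → Missing c z d′ → d ≡ d′
      coincide cg ch xy xz md md′ = third-colour-unique a b _ _ a≢b
        (differs cg xy md ma) (differs cg xy md mb) (differs ch xz md′ ma) (differs ch xz md′ mb)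

      swap : ∀ d → v ≢ w → Missing c v d → Missing c w d → ⊥
      swap d v≢w mv mw = case v ∈? S of λ where
          (no  v∉S) → extend ce xv v∉S mv
          -- Both `v` and `w` miss `d`, so both are fixed by its mate; the component of `x` has at
          -- most one such vertex, and `w` lies outside it.
          (yes v∈S) → extend cf xw
            (λ w∈S → v≢w (fixed v∈S w∈S (mate-missing mv) (mate-missing mw))) mw
        where
        -- The colour `a`, missing at the starting vertex `x`, takes the place of `true`.
        mates : Bool → Fin |V| → Fin |V|
        mates true  = mate c a
        mates false = mate c d

        mates-involutive : ∀ β y → mates β (mates β y) ≡ y
        mates-involutive true  = mate-involutive a proper
        mates-involutive false = mate-involutive d proper

        open AlternatingWalk mates mates-involutive

        path   = component x (mate-missing ma)
        S      = proj₁ path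
        x∈S    = proj₁ (proj₂ path)
        closed = proj₁ (proj₂ (proj₂ path))
        fixed  = proj₂ (proj₂ (proj₂ path))

        open Kempe {c = c} {a} {d} {S} proper (closed true) (closed false)

        extend : ∀ {g y} → c g ≡ nothing → Joins g x y → y ∉ S → Missing c y d → ⊥
        extend cg xy y∉ my = no-common-missing (kempe-optimal optimal) (kempe-uncoloured⁺ cg) xy
          (kempe-missing-∈ x∈S ma) (kempe-missing-∉ y∉ my)

  -- Disjoint triples of vertices from rotations.

  -- Recolouring the edge e with b and uncolouring g instead yields another optimal
  -- colouring, in which the uncoloured edge has moved to uw.
  record Rotation (c : Colouring 3) (e : Fin |E|) : Set where
    field
      {u v w} : Fin |V|
      {g}     : Fin |E|
      {b}     : Fin 3
      uv      : Joins e u v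
      uw      : Joins g u w
      mv      : Missing c v b
      cg      : c g ≡ just b

    corner : Fin 3 → Fin |V|
    corner zero             = u
    corner (suc zero)       = v
    corner (suc (suc zero)) = w

    ue : Incident G u e
    ue = proj₁ (proj₂ uv)

    ve : Incident G v e
    ve = proj₂ (proj₂ uv)

    ug : Incident G u g
    ug = proj₁ (proj₂ uw)

    wg : Incident G w g
    wg = proj₂ (proj₂ uw)

    v≢w : v ≢ w
    v≢w v≡w = mv g (subst (λ y → Incident G y g) (sym v≡w) wg) cg

    corner-injective : ∀ {i j} → corner i ≡ corner j → i ≡ j
    corner-injective {zero}           {zero}           _  = refl
    corner-injective {zero}           {suc zero}       eq = contradiction eq (proj₁ uv)
    corner-injective {zero}           {suc (suc zero)} eq = contradiction eq (proj₁ uw)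
    corner-injective {suc zero}       {zero}           eq = contradiction (sym eq) (proj₁ uv)
    corner-injective {suc zero}       {suc zero}       _  = refl
    corner-injective {suc zero}       {suc (suc zero)} eq = contradiction eq v≢w
    corner-injective {suc (suc zero)} {zero}           eq = contradiction (sym eq) (proj₁ uw)
    corner-injective {suc (suc zero)} {suc zero}       eq = contradiction (sym eq) v≢w
    corner-injective {suc (suc zero)} {suc (suc zero)} _  = refl

    corner-cases : ∀ i → Incident G (corner i) e ⊎ corner i ≡ w
    corner-cases zero             = inj₁ ue
    corner-cases (suc zero)       = inj₁ ve
    corner-cases (suc (suc zero)) = inj₂ refl

    w-not-incident : ¬ Incident G w e
    w-not-incident we with joins-only uv we
    ... | inj₁ w≡u = proj₁ uw (sym w≡u)
    ... | inj₂ w≡v = v≢w (sym w≡v)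

  open Rotation using (corner; corner-injective; corner-cases)

  -- A colour missing at one end of `e` is present at the other, since `e` could take it otherwise.
  rotation : ∀ {c e} → Optimal c → c e ≡ nothing → Rotation c e
  rotation {c} {e} opt ce =
    let uv = joins-ends e
        b , mv = missing-one {c} (proj₂ (proj₂ uv)) ce
        g , ug , cg = ¬missing⇒present λ mu → no-common-missing opt ce uv mu mv
    in record { uv = uv ; uw = proj₂ (incident⇒joins ug) ; mv = mv ; cg = cg }

  module _ {c : Colouring 3} {e : Fin |E|} (opt : Optimal c) (ce : c e ≡ nothing)
           (R : Rotation c e) where
    open Rotation R

    rotated : Colouring 3
    rotated = rotate c e g b

    rotated-optimal : Optimal rotated
    rotated-optimal = rotate-optimal opt ce uv mv ug cg

    uncoloured≢g : ∀ {f} → c f ≡ nothing → f ≢ g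
    uncoloured≢g cf refl = case trans (sym cf) cg of λ ()

    rotated-at-g : rotated g ≡ nothing
    rotated-at-g = rotate-at {c = c} (uncoloured≢g ce)

    rotated-uncoloured : ∀ {f} → f ≢ e → c f ≡ nothing → rotated f ≡ nothing
    rotated-uncoloured f≢e cf = trans (rotate-minimal {c = c} f≢e (uncoloured≢g cf)) cf

    -- After the rotation `g` is uncoloured at `w`. An uncoloured edge `f` at `w` is not `e`, so it
    -- stays uncoloured and meets `g` there; the matching property in the rotated colouring gives
    -- `f ≡ g`, although `g` was coloured.
    w-covered : ∀ {f} → c f ≡ nothing → ¬ Incident G w f
    w-covered {f} cf wf = uncoloured≢g cf
      (uncoloured-matching rotated-optimal (rotated-uncoloured f≢e cf) rotated-at-g wf wg)
      where
      f≢e : f ≢ e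
      f≢e refl = w-not-incident wf

  -- Suppose `e` and `f` differ and share `w`. After rotating at `e`, the edge `R.g` is uncoloured
  -- at `w`, while `T` is still a rotation for `f`; this contradicts `w-covered`, now for the
  -- rotated colouring.
  w-determines : ∀ {c e f} → Optimal c → c e ≡ nothing → c f ≡ nothing →
                 (R : Rotation c e) (T : Rotation c f) → Rotation.w R ≡ Rotation.w T → e ≡ f
  w-determines {c} {e} {f} opt ce cf R T w≡w′ = decidable-stable (e ≟ f) λ e≢f →
    w-covered (rotated-optimal opt ce R) (rotated-uncoloured opt ce R (e≢f ∘ sym) cf) (T′ e≢f)
      (rotated-at-g opt ce R) (subst (λ y → Incident G y R.g) w≡w′ R.wg)
    where
    module R = Rotation R
    module T = Rotation T

    T′ : e ≢ f → Rotation (rotated opt ce R) f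
    T′ e≢f = record
      { uv = T.uv
      ; uw = T.uw
      -- The only newly coloured edge is `e`, which does not meet `f`.
      ; mv = λ h vh ch → [ (λ { refl → e≢f (uncoloured-matching opt ce cf vh T.ve) })
                         , (λ { (_ , ch′) → T.mv h vh ch′ }) ]′ (rotate-just⁻ ch)
      ; cg = trans (rotate-minimal {c = c} (uncoloured≢g opt cf T ce ∘ sym) g≢g) T.cg
      }
      where
      g≢g : T.g ≢ R.g
      -- If both rotations used the same edge, `T.u` would be `R.u`, where `e` and `f` would meet,
      -- or the common vertex `w`, which differs from `T.u`.
      g≢g eq with joins-only R.uw (subst (Incident G T.u) eq T.ug)
      ... | inj₁ u≡u = e≢f (uncoloured-matching opt ce cf R.ue (subst (λ y → Incident G y f) u≡u T.ue))
      ... | inj₂ u≡w = proj₁ T.uw (trans u≡w w≡w′)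

  -- A shared corner is an end of both edges (matching property), the `w` of one and an end of the
  -- other (excluded by `w-covered`), or the `w` of both.
  corners-disjoint : ∀ {c e f} → Optimal c → c e ≡ nothing → c f ≡ nothing →
                     (R : Rotation c e) (T : Rotation c f) → ∀ {i j} →
                     corner R i ≡ corner T j → e ≡ f
  corners-disjoint {c} {e} {f} opt ce cf R T {i} {j} eq with corner-cases R i | corner-cases T j
  ... | inj₁ ie | inj₁ jf = uncoloured-matching opt ce cf ie (subst (λ y → Incident G y f) (sym eq) jf)
  ... | inj₁ ie | inj₂ j≡ = contradiction
          (subst (λ y → Incident G y e) (trans eq j≡) ie) (w-covered opt cf T ce)
  ... | inj₂ i≡ | inj₁ jf = contradiction
          (subst (λ y → Incident G y f) (trans (sym eq) i≡) jf) (w-covered opt ce R cf)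
  ... | inj₂ i≡ | inj₂ j≡ = w-determines opt ce cf R T (trans (sym i≡) (trans eq j≡))

  -- Counting corners and half-edges.

  ∣uncoloured∣*3≤|V| : ∀ {c : Colouring 3} → Optimal c → ∣ uncoloured c ∣ ℕ.* 3 ≤ |V|
  ∣uncoloured∣*3≤|V| {c} opt = pairs-injective⇒≤ (λ i → corner (R i)) injective
    where
    nth-uncoloured : ∀ i → c (nth (uncoloured c) i) ≡ nothing
    nth-uncoloured i = ∈-tabulate⁻ (uncoloured? c) (nth-∈ (uncoloured c) i)

    R : ∀ i → Rotation c (nth (uncoloured c) i)
    R i = rotation opt (nth-uncoloured i)

    injective : ∀ {i i′ j j′} → corner (R i) j ≡ corner (R i′) j′ → i ≡ i′ × j ≡ j′
    injective {i} {i′} {j} {j′} eq with nth-injective (uncoloured c)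
      (corners-disjoint opt (nth-uncoloured i) (nth-uncoloured i′) (R i) (R i′) {j} {j′} eq)
    ... | refl = refl , corner-injective (R i) eq

  -- Handshake count: each vertex has three incidences, and each edge has two sides to receive them.
  |V|*3≤|E|*2 : |V| ℕ.* 3 ≤ |E| ℕ.* 2
  |V|*3≤|E|*2 = pairs-injective⇒≤ half-edge half-edge-injective
    where
    edge : Fin |V| → Fin 3 → Fin |E|
    edge v i = nth (edgesAt G v) (subst Fin (sym (cubic v)) i)

    edge-incident : ∀ v i → Incident G v (edge v i)
    edge-incident v i = ∈-tabulate⁻ (incident? G v) (nth-∈ (edgesAt G v) _)

    side : ∀ {v e} → Incident G v e → Fin 2
    side (inj₁ _) = zero
    side (inj₂ _) = suc zero

    side-injective : ∀ {v v′ e e′} (ve : Incident G v e) (ve′ : Incident G v′ e′) →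
                     e ≡ e′ → side ve ≡ side ve′ → v ≡ v′
    side-injective (inj₁ refl) (inj₁ refl) refl _ = refl
    side-injective (inj₂ refl) (inj₂ refl) refl _ = refl

    half-edge : Fin |V| → Fin 3 → Fin (|E| ℕ.* 2)
    half-edge v i = combine (edge v i) (side (edge-incident v i))

    half-edge-injective : ∀ {v v′ i i′} → half-edge v i ≡ half-edge v′ i′ → v ≡ v′ × i ≡ i′
    half-edge-injective {v} {v′} {i} {i′} eq
      with combine-injective (edge v i) _ (edge v′ i′) _ eq
    ... | e≡ , s≡ with side-injective (edge-incident v i) (edge-incident v′ i′) e≡ s≡
    ...   | refl = refl , subst-injective (sym (cubic v)) (nth-injective (edgesAt G v) e≡)

-- Partial colourings and `ν`.

module _ {G : Multigraph} where
  open Multigraph G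
  open PartialColouring G

  proper⇒|E|≤ν+uncoloured : ∀ {c : Colouring 3} → Proper c → |E| ≤ ν 3 G + ∣ uncoloured c ∣
  proper⇒|E|≤ν+uncoloured {c} proper = begin
    |E|                ≤⟨ ℕ.m≤n+m∸n |E| r ⟩
    r + (|E| ∸ r)      ≡⟨ cong (_+_ r) (∣∁p∣≡n∸∣p∣ (uncoloured c)) ⟨
    r + ∣ ∁ (uncoloured c) ∣
      -- The default `zero` is never taken on the complement of the uncoloured edges.
      ≤⟨ ℕ.+-monoʳ-≤ r (ν-upper 3 G (∁ (uncoloured c)) (fromMaybe zero ∘ c , restricted)) ⟩
    r + ν 3 G          ≡⟨ ℕ.+-comm r (ν 3 G) ⟩
    ν 3 G + r          ∎
    where
    open ℕ.≤-Reasoning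
    r = ∣ uncoloured c ∣

    restricted : ProperOn G (∁ (uncoloured c)) (fromMaybe zero ∘ c)
    restricted e f e∈ f∈ (e≢f , v , ve , vf) eq with c e in ce | c f in cf
    ... | nothing | _       = x∈∁p⇒x∉p e∈ (∈-tabulate⁺ (uncoloured? c) ce)
    ... | just _  | nothing = x∈∁p⇒x∉p f∈ (∈-tabulate⁺ (uncoloured? c) cf)
    ... | just _  | just _  = e≢f (proper ve vf ce (trans cf (cong just (sym eq))))

  -- A 3-edge-colouring of a maximum colourable subgraph `H`, extended by `nothing`, leaves at most
  -- `|E| ∸ ν 3 G` edges uncoloured; the preceding bound shows that no proper colouring leaves
  -- fewer.
  optimal-exists : ∃[ c ] Optimal {3} c
  optimal-exists with ν-attained 3 G
  ... | H , (c₀ , proper₀) , ∣H∣≡ν = c , proper , optimal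
    where
    c : Colouring 3
    c e with e ∈? H
    ... | yes _ = just (c₀ e)
    ... | no  _ = nothing

    just⁻ : ∀ {e a} → c e ≡ just a → e ∈ H × c₀ e ≡ a
    just⁻ {e} eq with e ∈? H
    ... | yes e∈H = e∈H , just-injective eq

    nothing⁻ : ∀ {e} → c e ≡ nothing → e ∉ H
    nothing⁻ {e} eq with e ∈? H
    ... | no e∉H = e∉H

    proper : Proper c
    proper {x} {e} {f} xe xf ce cf = decidable-stable (e ≟ f) λ e≢f →
      let e∈ , eq = just⁻ ce
          f∈ , eq′ = just⁻ cf
      in proper₀ e f e∈ f∈ (e≢f , x , xe , xf) (trans eq (sym eq′))

    optimal : ∀ c′ → Proper c′ → ∣ uncoloured c ∣ ≤ ∣ uncoloured c′ ∣
    optimal c′ proper′ = begin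
      ∣ uncoloured c ∣  ≤⟨ p⊆q⇒∣p∣≤∣q∣ (λ e∈ → x∉p⇒x∈∁p (nothing⁻ (∈-tabulate⁻ (uncoloured? c) e∈))) ⟩
      ∣ ∁ H ∣           ≡⟨ ∣∁p∣≡n∸∣p∣ H ⟩
      |E| ∸ ∣ H ∣       ≡⟨ cong (|E| ∸_) ∣H∣≡ν ⟩
      |E| ∸ ν 3 G       ≤⟨ ℕ.m≤n+o⇒m∸n≤o |E| (ν 3 G) (proper⇒|E|≤ν+uncoloured proper′) ⟩
      ∣ uncoloured c′ ∣ ∎
      where open ℕ.≤-Reasoning

-- The final inequality.

ν₃-bound : ∀ (G : Multigraph) → Cubic G → 7 ℕ.* Multigraph.|V| G ≤ 6 ℕ.* ν 3 G
ν₃-bound G cubic with optimal-exists {G}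
-- Adding `2 |V|` to both sides avoids subtraction: it absorbs the `6 r` arising from the uncoloured
-- edges.
... | c , opt = ℕ.+-cancelʳ-≤ (2 ℕ.* |V|) _ _ (begin
  7 ℕ.* |V| + 2 ℕ.* |V|
    ≡⟨ solve 1 (λ n → con 7 :* n :+ con 2 :* n := con 3 :* (n :* con 3)) refl |V| ⟩
  3 ℕ.* (|V| ℕ.* 3)
    ≤⟨ ℕ.*-monoʳ-≤ 3 (|V|*3≤|E|*2 {G} cubic) ⟩
  3 ℕ.* (|E| ℕ.* 2)
    ≤⟨ ℕ.*-monoʳ-≤ 3 (ℕ.*-monoˡ-≤ 2 (proper⇒|E|≤ν+uncoloured {G} (proj₁ opt))) ⟩
  3 ℕ.* ((ν 3 G + r) ℕ.* 2)
    ≡⟨ solve 2 (λ m r → con 3 :* ((m :+ r) :* con 2) := con 6 :* m :+ con 2 :* (r :* con 3))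
         refl (ν 3 G) r ⟩
  6 ℕ.* ν 3 G + 2 ℕ.* (r ℕ.* 3)
    ≤⟨ ℕ.+-monoʳ-≤ (6 ℕ.* ν 3 G) (ℕ.*-monoʳ-≤ 2 (∣uncoloured∣*3≤|V| {G} cubic opt)) ⟩
  6 ℕ.* ν 3 G + 2 ℕ.* |V| ∎)
  where
  open Multigraph G
  open PartialColouring G
  open ℕ.≤-Reasoning
  open +-*-Solver
  r = ∣ uncoloured c ∣

theorem3 : (G : Multigraph) → Cubic G →
    (+ ν 3 G) / 1 ≥ ((+ 7) / 6) * ((+ Multigraph.|V| G) / 1)
theorem3 G cubic = ℚ.toℚᵘ-cancel-≤ (begin
  toℚᵘ (((+ 7) / 6) * ((+ n) / 1))
    ≃⟨ ℚ.toℚᵘ-homo-* ((+ 7) / 6) ((+ n) / 1) ⟩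
  toℚᵘ ((+ 7) / 6) ℚᵘ.* toℚᵘ ((+ n) / 1)
    ≃⟨ ℚᵘ.*-congˡ {toℚᵘ ((+ 7) / 6)} (ℚ.toℚᵘ-fromℚᵘ (ℚᵘ.mkℚᵘ (+ n) 0)) ⟩
  -- `mkℚᵘ` stores the denominator minus one: 5 and 0 stand for 6 and 1.
  ℚᵘ.mkℚᵘ (+ 7) 5 ℚᵘ.* ℚᵘ.mkℚᵘ (+ n) 0
    ≤⟨ ℚᵘ.*≤* integral ⟩
  ℚᵘ.mkℚᵘ (+ ν 3 G) 0
    ≃⟨ ℚ.toℚᵘ-fromℚᵘ (ℚᵘ.mkℚᵘ (+ ν 3 G) 0) ⟨
  toℚᵘ ((+ ν 3 G) / 1) ∎)
  where
  open ℚᵘ.≤-Reasoning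
  n = Multigraph.|V| G

  integral : (+ 7 ℤ.* + n) ℤ.* + 1 ℤ.≤ + ν 3 G ℤ.* + 6
  integral = subst₂ ℤ._≤_
    (sym (trans (ℤ.*-identityʳ (+ 7 ℤ.* + n)) (sym (ℤ.pos-* 7 n))))
    (trans (cong +_ (ℕ.*-comm 6 (ν 3 G))) (ℤ.pos-* (ν 3 G) 6))
    (ℤ.+≤+ (ν₃-bound G cubic))
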